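{- Let $\mathcal{B}$ be the set of all $\beta(1,0)$-trees and let $h:\mathcal{B}\to\mathcal{B}$ be the map defined recursively by $h(\bullet)=\bullet$, $h(\lambda_i t)=\gamma_i h(t)$ for $t\in\mathcal{B}$ and $1\le i\le \operatorname{root} t$, and $h(u\oplus v)=h(v)\oslash h(u)$ for $u,v\in\mathcal{B}\setminus\{\bullet\}$. Then $h$ is an involution, i.e. $h(h(t))=t$ for every $t\in\mathcal{B}$.
   Context: A $\beta(1,0)$-tree is a rooted plane tree (children of each node are linearly ordered left to right) whose nodes are labeled with positive integers such that: (1) leaves have label $1$; (2) the root has label equal to the sum of its children's labels; (3) any other non-leaf node has label no greater than the sum of its children's labels. The single-node tree, whose only node has label $1$, is a $\beta(1,0)$-tree and is denoted $\bullet$ (it is exempt from (2)). $\mathcal{B}$ is the set of all $\beta(1,0)$-trees. $\operatorname{root} t$ is the label of the root of $t$. The right path of $t$ is the path from the root to the rightmost leaf (always go to the last child); $\operatorname{rpath} t$ is its number of edges. Operations: - For $u,v\in\mathcal{B}\setminus\{\bullet\}$, $u\oplus v$ is the tree obtained by identifying the roots: its root label is $\operatorname{root} u+\operatorname{root} v$, and the subtrees at its root are those of $u$ followed by those of $v$. - For $t\in\mathcal{B}$ and $1\le i\le\operatorname{root} t$, $\lambda_i t$ is obtained from $t$ by adding a new root whose only child is the old root; both the new root and the old root are assigned the label $i$. - For $u,v\in\mathcal{B}\setminus\{\bullet\}$, $u\oslash v$ is obtained by identifying the rightmost leaf of $u$ with the root of $v$; the identified node gets label $1$, and all other labels are kept.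 - For $t\in\mathcal{B}\setminus\{\bullet\}$ and $1\le i\le \operatorname{rpath} t$, let $x$ be the $i$th node on the right path of $t$ (the root being the first). Then $\gamma_i t$ is obtained by attaching to $x$ a new leaf (label $1$) as the new last child of $x$, and adding $1$ to the label of each node on the path from the root to $x$ (inclusive). By convention $\gamma_1\bullet$ is the tree with two nodes, both labeled $1$. The operations $\oplus$ and $\oslash$ are associative. Every $\beta(1,0)$-tree is of exactly one of the forms $\bullet$; $\lambda_i u$ with $u\in\mathcal{B}$, $1\le i\le\operatorname{root}u$ (root has exactly one child; $i$ and $u$ are then unique); $u\oplus v$ with $u,v\neq\bullet$ (root has at least two children; the decomposition into a sum of trees of the form $\lambda_i u$ is unique). Hence the recursion determines $h$ (one has $\operatorname{rpath} h(t)=\operatorname{root} t$ for $t\ne\bullet$, so $\gamma_i h(t)$ is always defined). -}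

module Defs where

open import Data.List.Base using (List; []; _∷_; [_]; _++_; map)
open import Data.List.Properties using (map-++)
open import Data.List.Relation.Unary.All using (All; []; _∷_)
open import Data.List.Relation.Unary.All.Properties using (++⁺)
open import Data.Nat.Base using (ℕ; zero; suc; pred; _+_; _≤_; _<_; z≤n; s≤s)
open import Data.Nat.ListAction using (sum)
open import Data.Nat.ListAction.Properties using (sum-++)
open import Data.Nat.Properties
open import Function.Base using (_∘_)
open import Relation.Binary.PropositionalEquality
  using (_≡_; _≢_; refl; sym; trans; cong; cong₂; subst)
open import Relation.Nullary using (contradiction)

data Tree : Set where
  node : (label : ℕ) (children : List Tree) → Tree

Forest : Set
Forest = List Tree

label : Tree → ℕ
label (node a _) = a

children : Tree → Forest
children (node _ cs) = cs

labelSum : Forest → ℕ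
labelSum = sum ∘ map label

leaf : Tree
leaf = node 1 []

-- Subtrees at a node other than the root of the whole tree.
data Admissible : Tree → Set where
  external : Admissible leaf
  inner    : ∀ {a c cs} → 1 ≤ a → a ≤ labelSum (c ∷ cs) →
             All Admissible (c ∷ cs) → Admissible (node a (c ∷ cs))

-- Positivity of the root label follows from positivity of the labels of its
-- children.
data Valid : Tree → Set where
  single : Valid leaf
  rooted : ∀ {a c cs} → a ≡ labelSum (c ∷ cs) →
           All Admissible (c ∷ cs) → Valid (node a (c ∷ cs))

record ℬ : Set where
  constructor _,_
  field
    tree  : Tree
    valid : Valid tree

open ℬ public

mutual
  Admissible-irrelevant : ∀ {t} (p q : Admissible t) → p ≡ q
  Admissible-irrelevant external external = refl
  Admissible-irrelevant (inner p q r) (inner p′ q′ r′)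
    with refl ← ≤-irrelevant p p′ | refl ← ≤-irrelevant q q′
       | refl ← All-irrelevant r r′ = refl

  All-irrelevant : ∀ {ts} (p q : All Admissible ts) → p ≡ q
  All-irrelevant []       []         = refl
  All-irrelevant (p ∷ ps) (q ∷ qs) =
    cong₂ _∷_ (Admissible-irrelevant p q) (All-irrelevant ps qs)

Valid-irrelevant : ∀ {t} (p q : Valid t) → p ≡ q
Valid-irrelevant single single = refl
Valid-irrelevant (rooted p r) (rooted p′ r′)
  with refl ← ≡-irrelevant p p′ | refl ← All-irrelevant r r′ = refl

ℬ-≡ : ∀ {t u : ℬ} → tree t ≡ tree u → t ≡ u
ℬ-≡ {t , p} {_ , q} refl = cong (t ,_) (Valid-irrelevant p q)

• : ℬ
• = leaf , single

root : ℬ → ℕ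
root t = label (tree t)

-- Number of edges of the right path of a node with the given children.
rpathᶠ : Forest → ℕ
rpathᶠ []               = 0
rpathᶠ (_ ∷ c ∷ cs)     = rpathᶠ (c ∷ cs)
rpathᶠ (node _ cs ∷ []) = suc (rpathᶠ cs)

rpathᵗ : Tree → ℕ
rpathᵗ t = rpathᶠ (children t)

rpath : ℬ → ℕ
rpath t = rpathᵗ (tree t)

_⊕ᵗ_ : Tree → Tree → Tree
node a cs ⊕ᵗ node b ds = node (a + b) (cs ++ ds)

λᵗ : ℕ → Tree → Tree
λᵗ i (node _ cs) = node i [ node i cs ]

-- The identified node keeps the label of the rightmost leaf of the left
-- operand, which is 1 as soon as that operand is valid.
_⊘ᶠ_ : Forest → Forest → Forest
[]                 ⊘ᶠ ds = ds
(c ∷ cs@(_ ∷ _))   ⊘ᶠ ds = c ∷ (cs ⊘ᶠ ds)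
(node a cs ∷ [])   ⊘ᶠ ds = [ node a (cs ⊘ᶠ ds) ]

_⊘ᵗ_ : Tree → Tree → Tree
node a cs ⊘ᵗ node _ ds = node a (cs ⊘ᶠ ds)

-- attach k cs is the new list of children of a node with children cs when
-- the leaf is attached k edges below that node on its right path.  The
-- label of the node itself is dealt with by the caller.
attach : ℕ → Forest → Forest
attach zero    cs               = cs ++ [ leaf ]
attach (suc k) []               = []
attach (suc k) (c ∷ cs@(_ ∷ _)) = c ∷ attach (suc k) cs
attach (suc k) (node a cs ∷ []) = [ node (suc a) (attach k cs) ]

-- The ith node of the right path lies i - 1 edges below the root.  The first
-- clause is the convention for γ₁ •, whose root label is 1 and not 2.
γᵗ : ℕ → Tree → Tree
γᵗ i (node _ [])           = node 1 [ leaf ]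
γᵗ i (node a cs@(_ ∷ _))  = node (suc a) (attach (pred i) cs)

labelSum-++ : ∀ cs ds → labelSum (cs ++ ds) ≡ labelSum cs + labelSum ds
labelSum-++ cs ds =
  trans (cong sum (map-++ label cs ds)) (sum-++ (map label cs) (map label ds))

inner′ : ∀ {a} cs → 1 ≤ a → a ≤ labelSum cs → All Admissible cs →
         Admissible (node a cs)
inner′ []      1≤a a≤0 _ = contradiction (≤-trans 1≤a a≤0) λ ()
inner′ (_ ∷ _) 1≤a a≤s r = inner 1≤a a≤s r

rooted′ : ∀ {a} cs → 1 ≤ a → a ≡ labelSum cs → All Admissible cs →
          Valid (node a cs)
rooted′ []      () refl _
rooted′ (_ ∷ _) _  a≡s  r = rooted a≡s r

label-pos : ∀ {t} → Admissible t → 1 ≤ label t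
label-pos external        = s≤s z≤n
label-pos (inner 1≤a _ _) = 1≤a

root-pos : ∀ {t} → Valid t → 1 ≤ label t
root-pos single                = s≤s z≤n
root-pos (rooted refl (p ∷ _)) = ≤-trans (label-pos p) (m≤m+n _ _)

children-adm : ∀ {t} → Valid t → All Admissible (children t)
children-adm single       = []
children-adm (rooted _ r) = r

⊕ᵗ-valid : ∀ {s t} → Valid s → Valid t → s ≢ leaf → t ≢ leaf → Valid (s ⊕ᵗ t)
⊕ᵗ-valid single       _      s≢• _   = contradiction refl s≢•
⊕ᵗ-valid (rooted _ _) single _   t≢• = contradiction refl t≢•
⊕ᵗ-valid {node _ cs} {node _ ds} (rooted p r) (rooted q s) _ _ =
  rooted (trans (cong₂ _+_ p q) (sym (labelSum-++ cs ds))) (++⁺ r s)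

λᵗ-valid : ∀ {i t} → Valid t → 1 ≤ i → i ≤ label t → Valid (λᵗ i t)
λᵗ-valid single (s≤s z≤n) (s≤s z≤n) = rooted refl (external ∷ [])
λᵗ-valid (rooted refl r) 1≤i i≤s =
  rooted (sym (+-identityʳ _)) (inner 1≤i i≤s r ∷ [])

⊘ᶠ-labelSum : ∀ c cs ds → labelSum ((c ∷ cs) ⊘ᶠ ds) ≡ labelSum (c ∷ cs)
⊘ᶠ-labelSum (node _ _) []       ds = refl
⊘ᶠ-labelSum c          (d ∷ cs) ds = cong (label c +_) (⊘ᶠ-labelSum d cs ds)

⊘ᶠ-adm : ∀ {cs ds} → 1 ≤ labelSum ds → All Admissible cs →
         All Admissible ds → All Admissible (cs ⊘ᶠ ds)
⊘ᶠ-adm pos [] s = s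
⊘ᶠ-adm {ds = ds} pos (external ∷ []) s = inner′ ds (s≤s z≤n) pos s ∷ []
⊘ᶠ-adm {ds = ds} pos (inner {c = c} {cs} 1≤a a≤s r ∷ []) s =
  inner′ ((c ∷ cs) ⊘ᶠ ds) 1≤a
    (≤-trans a≤s (≤-reflexive (sym (⊘ᶠ-labelSum c cs ds))))
    (⊘ᶠ-adm pos r s) ∷ []
⊘ᶠ-adm pos (p ∷ r@(_ ∷ _)) s = p ∷ ⊘ᶠ-adm pos r s

⊘ᵗ-valid : ∀ {s t} → Valid s → Valid t → s ≢ leaf → t ≢ leaf → Valid (s ⊘ᵗ t)
⊘ᵗ-valid single       _      s≢• _   = contradiction refl s≢•
⊘ᵗ-valid (rooted _ _) single _   t≢• = contradiction refl t≢•
⊘ᵗ-valid {node _ (c ∷ cs)} {node _ ds} u@(rooted p r) v@(rooted q s) _ _ =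
  rooted′ ((c ∷ cs) ⊘ᶠ ds) (root-pos u) (trans p (sym (⊘ᶠ-labelSum c cs ds)))
    (⊘ᶠ-adm (subst (1 ≤_) q (root-pos v)) r s)

attach-labelSum : ∀ k cs → k < rpathᶠ cs →
                  labelSum (attach k cs) ≡ suc (labelSum cs)
attach-labelSum zero    cs _ = trans (labelSum-++ cs [ leaf ]) (+-comm _ 1)
attach-labelSum (suc k) (node _ _ ∷ []) _ = refl
attach-labelSum (suc k) (c ∷ cs@(_ ∷ _)) k< =
  trans (cong (label c +_) (attach-labelSum (suc k) cs k<)) (+-suc _ _)

attach-adm : ∀ k {cs} → k < rpathᶠ cs → All Admissible cs →
             All Admissible (attach k cs)
attach-adm zero    _ r = ++⁺ r (external ∷ [])
attach-adm (suc k) (s≤s ()) (external ∷ [])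
attach-adm (suc k) (s≤s k<) (inner {c = c} {cs} _ a≤s r ∷ []) =
  inner′ (attach k (c ∷ cs)) (s≤s z≤n)
    (≤-trans (s≤s a≤s) (≤-reflexive (sym (attach-labelSum k (c ∷ cs) k<))))
    (attach-adm k k< r) ∷ []
attach-adm (suc k) k< (p ∷ r@(_ ∷ _)) = p ∷ attach-adm (suc k) k< r

-- The pairs t, i for which γᵢ t is defined.  Since rpath • = 0, the second
-- constructor only applies to trees other than •.
data γ-Index : Tree → ℕ → Set where
  single : γ-Index leaf 1
  path   : ∀ {t i} → 1 ≤ i → i ≤ rpathᵗ t → γ-Index t i

γᵗ-valid : ∀ {t i} → Valid t → γ-Index t i → Valid (γᵗ i t)
γᵗ-valid _      single             = rooted refl (external ∷ [])
γᵗ-valid single (path (s≤s z≤n) ())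
γᵗ-valid {node _ cs} (rooted p r) (path {i = suc k} _ k<) =
  rooted′ (attach k cs) (s≤s z≤n)
    (trans (cong suc p) (sym (attach-labelSum k cs k<)))
    (attach-adm k k< r)

λᵢ : (i : ℕ) (t : ℬ) → 1 ≤ i → i ≤ root t → ℬ
λᵢ i t 1≤i i≤root = λᵗ i (tree t) , λᵗ-valid (valid t) 1≤i i≤root

γᵢ : (i : ℕ) (t : ℬ) → γ-Index (tree t) i → ℬ
γᵢ i t p = γᵗ i (tree t) , γᵗ-valid (valid t) p

≢•⇒≢leaf : ∀ {t} → t ≢ • → tree t ≢ leaf
≢•⇒≢leaf t≢• eq = t≢• (ℬ-≡ eq)

_⊕_[_,_] : (u v : ℬ) → u ≢ • → v ≢ • → ℬ
u ⊕ v [ u≢• , v≢• ] =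
  (tree u ⊕ᵗ tree v) ,
  ⊕ᵗ-valid (valid u) (valid v) (≢•⇒≢leaf u≢•) (≢•⇒≢leaf v≢•)

_⊘_[_,_] : (u v : ℬ) → u ≢ • → v ≢ • → ℬ
u ⊘ v [ u≢• , v≢• ] =
  (tree u ⊘ᵗ tree v) ,
  ⊘ᵗ-valid (valid u) (valid v) (≢•⇒≢leaf u≢•) (≢•⇒≢leaf v≢•)

-- A root label is determined by the children, so h is computed from the
-- list of children: a child node i cs stands for the summand λᵢ u, where u
-- is the tree whose root has children cs.  The defining equations of h are
-- h-•, h-λ and h-⊕ below.
hᶠ : Forest → Tree
hᶠ []                       = leaf
hᶠ (node i cs ∷ [])         = γᵗ i (hᶠ cs)
hᶠ (node i cs ∷ ds@(_ ∷ _)) = hᶠ ds ⊘ᵗ γᵗ i (hᶠ cs)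

rpath-⊘ᶠ : ∀ cs ds → rpathᶠ (cs ⊘ᶠ ds) ≡ rpathᶠ cs + rpathᶠ ds
rpath-⊘ᶠ [] ds = refl
rpath-⊘ᶠ (node _ cs ∷ []) ds = cong suc (rpath-⊘ᶠ cs ds)
rpath-⊘ᶠ (_ ∷ node a cs ∷ []) ds = rpath-⊘ᶠ (node a cs ∷ []) ds
rpath-⊘ᶠ (_ ∷ c ∷ cs@(_ ∷ _)) ds = rpath-⊘ᶠ (c ∷ cs) ds

rpath-∷ʳ : ∀ cs → rpathᶠ (cs ++ [ leaf ]) ≡ 1
rpath-∷ʳ []               = refl
rpath-∷ʳ (_ ∷ [])         = refl
rpath-∷ʳ (_ ∷ cs@(_ ∷ _)) = rpath-∷ʳ cs

rpath-attach : ∀ k cs → k < rpathᶠ cs → rpathᶠ (attach k cs) ≡ suc k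
rpath-attach zero    cs _ = rpath-∷ʳ cs
rpath-attach (suc k) (node _ cs ∷ []) (s≤s k<) = cong suc (rpath-attach k cs k<)
rpath-attach (suc k) (_ ∷ node a cs ∷ []) k< =
  rpath-attach (suc k) (node a cs ∷ []) k<
rpath-attach (suc k) (_ ∷ c ∷ cs@(_ ∷ _)) k< =
  rpath-attach (suc k) (c ∷ cs) k<

rpath-γᵗ : ∀ {t i} → γ-Index t i → rpathᵗ (γᵗ i t) ≡ i
rpath-γᵗ single = refl
rpath-γᵗ {node _ []} (path (s≤s z≤n) ())
rpath-γᵗ {node _ cs@(_ ∷ _)} (path {i = suc k} _ k<) = rpath-attach k cs k<

rpath-⊘ᵗ : ∀ s t → rpathᵗ (s ⊘ᵗ t) ≡ rpathᵗ s + rpathᵗ t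
rpath-⊘ᵗ (node _ cs) (node _ ds) = rpath-⊘ᶠ cs ds

rpath-pos⇒≢leaf : ∀ {t} → 1 ≤ rpathᵗ t → t ≢ leaf
rpath-pos⇒≢leaf () refl

mutual
  rpath-hᶠ : ∀ {cs} → All Admissible cs → rpathᵗ (hᶠ cs) ≡ labelSum cs
  rpath-hᶠ [] = refl
  rpath-hᶠ {node _ _ ∷ []} (p ∷ []) =
    trans (rpath-γᵗ (hᶠ-index p)) (sym (+-identityʳ _))
  rpath-hᶠ {node i bs ∷ ds@(_ ∷ _)} (p ∷ r@(_ ∷ _)) =
    trans (rpath-⊘ᵗ (hᶠ ds) (γᵗ i (hᶠ bs)))
      (trans (cong₂ _+_ (rpath-hᶠ r) (rpath-γᵗ (hᶠ-index p))) (+-comm _ i))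

  hᶠ-index : ∀ {i cs} → Admissible (node i cs) → γ-Index (hᶠ cs) i
  hᶠ-index external = single
  hᶠ-index (inner 1≤a a≤s r) =
    path 1≤a (≤-trans a≤s (≤-reflexive (sym (rpath-hᶠ r))))

γᵗhᶠ-≢leaf : ∀ {i cs} → Admissible (node i cs) → γᵗ i (hᶠ cs) ≢ leaf
γᵗhᶠ-≢leaf p = rpath-pos⇒≢leaf
  (≤-trans (label-pos p) (≤-reflexive (sym (rpath-γᵗ (hᶠ-index p)))))

hᶠ-≢leaf : ∀ {c cs} → All Admissible (c ∷ cs) → hᶠ (c ∷ cs) ≢ leaf
hᶠ-≢leaf r@(p ∷ _) = rpath-pos⇒≢leaf
  (≤-trans (≤-trans (label-pos p) (m≤m+n _ _))
           (≤-reflexive (sym (rpath-hᶠ r))))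

mutual
  hᶠ-valid : ∀ {cs} → All Admissible cs → Valid (hᶠ cs)
  hᶠ-valid [] = single
  hᶠ-valid {node _ _ ∷ []} (p ∷ []) = γᵗhᶠ-valid p
  hᶠ-valid {node _ _ ∷ _ ∷ _} (p ∷ r@(_ ∷ _)) =
    ⊘ᵗ-valid (hᶠ-valid r) (γᵗhᶠ-valid p) (hᶠ-≢leaf r) (γᵗhᶠ-≢leaf p)

  γᵗhᶠ-valid : ∀ {i cs} → Admissible (node i cs) → Valid (γᵗ i (hᶠ cs))
  γᵗhᶠ-valid external        = γᵗ-valid single single
  γᵗhᶠ-valid p@(inner _ _ r) = γᵗ-valid (hᶠ-valid r) (hᶠ-index p)

h : ℬ → ℬ
h t = hᶠ (children (tree t)) , hᶠ-valid (children-adm (valid t))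

rpath-h : ∀ {t} → t ≢ • → rpath (h t) ≡ root t
rpath-h {_ , single}        t≢• = contradiction refl t≢•
rpath-h {_ , rooted refl r} _   = rpath-hᶠ r

h-≢• : ∀ {t} → t ≢ • → h t ≢ •
h-≢• {t} t≢• ht≡• = rpath-pos⇒≢leaf
  (≤-trans (root-pos (valid t)) (≤-reflexive (sym (rpath-h t≢•))))
  (cong tree ht≡•)

h-index : ∀ {i} t → 1 ≤ i → i ≤ root t → γ-Index (tree (h t)) i
h-index (_ , single) (s≤s z≤n) (s≤s z≤n) = single
h-index (_ , rooted refl r) 1≤i i≤s =
  path 1≤i (≤-trans i≤s (≤-reflexive (sym (rpath-hᶠ r))))

h-• : h • ≡ •
h-• = refl

h-λ : ∀ i t (1≤i : 1 ≤ i) (i≤r : i ≤ root t) →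
      h (λᵢ i t 1≤i i≤r) ≡ γᵢ i (h t) (h-index t 1≤i i≤r)
h-λ i (node _ _ , _) 1≤i i≤r = ℬ-≡ refl

⊘ᶠ-assoc : ∀ bs cs ds → (bs ⊘ᶠ cs) ⊘ᶠ ds ≡ bs ⊘ᶠ (cs ⊘ᶠ ds)
⊘ᶠ-assoc [] cs ds = refl
⊘ᶠ-assoc (node a bs ∷ []) cs ds = cong (λ es → [ node a es ]) (⊘ᶠ-assoc bs cs ds)
⊘ᶠ-assoc (b ∷ node a bs ∷ []) cs ds =
  cong (b ∷_) (⊘ᶠ-assoc (node a bs ∷ []) cs ds)
⊘ᶠ-assoc (b ∷ b′ ∷ bs@(_ ∷ _)) cs ds = cong (b ∷_) (⊘ᶠ-assoc (b′ ∷ bs) cs ds)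

⊘ᵗ-assoc : ∀ t u v → (t ⊘ᵗ u) ⊘ᵗ v ≡ t ⊘ᵗ (u ⊘ᵗ v)
⊘ᵗ-assoc (node a bs) (node _ cs) (node _ ds) = cong (node a) (⊘ᶠ-assoc bs cs ds)

hᶠ-++ : ∀ c cs d ds →
        hᶠ ((c ∷ cs) ++ (d ∷ ds)) ≡ hᶠ (d ∷ ds) ⊘ᵗ hᶠ (c ∷ cs)
hᶠ-++ (node _ _) [] d ds = refl
hᶠ-++ (node i bs) (c ∷ cs) d ds =
  trans (cong (_⊘ᵗ γᵗ i (hᶠ bs)) (hᶠ-++ c cs d ds))
        (⊘ᵗ-assoc (hᶠ (d ∷ ds)) (hᶠ (c ∷ cs)) (γᵗ i (hᶠ bs)))

h-⊕ : ∀ u v (u≢• : u ≢ •) (v≢• : v ≢ •) →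
      h (u ⊕ v [ u≢• , v≢• ]) ≡ h v ⊘ h u [ h-≢• v≢• , h-≢• u≢• ]
h-⊕ (_ , single) _ u≢• _ = contradiction refl u≢•
h-⊕ (_ , rooted _ _) (_ , single) _ v≢• = contradiction refl v≢•
h-⊕ (node _ (c ∷ cs) , rooted _ _) (node _ (d ∷ ds) , rooted _ _) _ _ =
  ℬ-≡ (hᶠ-++ c cs d ds)

{-# OPTIONS --safe #-}
-- The map h exchanges ⊕ with ⊘ and λᵢ with γᵢ.  The two identities that are
-- not part of its definition, h (u ⊘ v) = h v ⊕ h u and h (γᵢ t) = λᵢ (h t),
-- follow by induction along the right path from
--   (u ⊕ v) ⊘ w = u ⊕ (v ⊘ w),     γᵢ (u ⊕ v) = u ⊕ γᵢ v,
--   λᵢ u ⊘ v = λᵢ (u ⊘ v),         γᵢ₊₁ (λₖ t) = λₖ₊₁ (γᵢ t),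
--   λ₁ • ⊘ t = λ₁ t,               γ₁ t = t ⊕ λ₁ •.
-- Hence h ∘ h commutes with ⊕ and with every λᵢ, and so fixes every tree.
module Submission where

open import Defs
open import Data.List.Base using ([]; _∷_; [_]; _++_)
open import Data.List.Properties using (++-assoc)
open import Data.List.Relation.Unary.All using (All; []; _∷_)
open import Data.Nat.Base using (zero; suc; pred; _+_; _≤_; _<_; s≤s)
open import Data.Nat.Properties using (+-comm; +-suc; +-identityʳ)
open import Relation.Binary.PropositionalEquality
  using (_≡_; refl; sym; trans; cong; cong₂; module ≡-Reasoning)

open ≡-Reasoning

-- Matching on `cons` exposes a first child, so that the `_ ∷ _` clauses of `attach`, `⊘ᶠ`, `γᵗ` and
-- `hᶠ` can reduce.
data NonEmpty : Forest → Set where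
  cons : ∀ {c cs} → NonEmpty (c ∷ cs)

attach-nonEmpty : ∀ k c cs → NonEmpty (attach k (c ∷ cs))
attach-nonEmpty zero    _          _       = cons
attach-nonEmpty (suc _) (node _ _) []      = cons
attach-nonEmpty (suc _) _          (_ ∷ _) = cons

⊘ᶠ-nonEmpty : ∀ c cs ds → NonEmpty ((c ∷ cs) ⊘ᶠ ds)
⊘ᶠ-nonEmpty (node _ _) []      _ = cons
⊘ᶠ-nonEmpty _          (_ ∷ _) _ = cons

γᵗ-nonEmpty : ∀ i t → NonEmpty (children (γᵗ i t))
γᵗ-nonEmpty _ (node _ [])       = cons
γᵗ-nonEmpty i (node _ (c ∷ cs)) = attach-nonEmpty (pred i) c cs

⊘ᵗ-nonEmpty : ∀ s t → NonEmpty (children s) → NonEmpty (children (s ⊘ᵗ t))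
⊘ᵗ-nonEmpty (node _ (c ∷ cs)) (node _ ds) cons = ⊘ᶠ-nonEmpty c cs ds

hᶠ-nonEmpty : ∀ c cs → NonEmpty (children (hᶠ (c ∷ cs)))
hᶠ-nonEmpty (node i bs) []       = γᵗ-nonEmpty i (hᶠ bs)
hᶠ-nonEmpty (node i bs) (d ∷ ds) = ⊘ᵗ-nonEmpty (hᶠ (d ∷ ds)) _ (hᶠ-nonEmpty d ds)

-- The right path enters the last child, which belongs to `c ∷ cs`.
attach-++ : ∀ k bs c cs → attach k (bs ++ c ∷ cs) ≡ bs ++ attach k (c ∷ cs)
attach-++ zero    bs           c cs = ++-assoc bs (c ∷ cs) [ leaf ]
attach-++ (suc _) []           _ _  = refl
attach-++ (suc _) (_ ∷ [])     _ _  = refl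
attach-++ (suc k) (b ∷ d ∷ bs) c cs = cong (b ∷_) (attach-++ (suc k) (d ∷ bs) c cs)

++-⊘ᶠ : ∀ bs c cs ds → (bs ++ c ∷ cs) ⊘ᶠ ds ≡ bs ++ ((c ∷ cs) ⊘ᶠ ds)
++-⊘ᶠ []           _ _  _  = refl
++-⊘ᶠ (_ ∷ [])     _ _  _  = refl
++-⊘ᶠ (b ∷ d ∷ bs) c cs ds = cong (b ∷_) (++-⊘ᶠ (d ∷ bs) c cs ds)

⊕ᵗ-⊘ᵗ : ∀ s t u → NonEmpty (children t) → (s ⊕ᵗ t) ⊘ᵗ u ≡ s ⊕ᵗ (t ⊘ᵗ u)
⊕ᵗ-⊘ᵗ (node a bs) (node b (c ∷ cs)) (node _ ds) cons =
  cong (node (a + b)) (++-⊘ᶠ bs c cs ds)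

λᵗ-⊘ᵗ : ∀ i s t → NonEmpty (children s) → λᵗ i s ⊘ᵗ t ≡ λᵗ i (s ⊘ᵗ t)
λᵗ-⊘ᵗ _ (node _ (_ ∷ _)) (node _ _) cons = refl

λ₁leaf-⊘ᵗ : ∀ t → λᵗ 1 leaf ⊘ᵗ t ≡ λᵗ 1 t
λ₁leaf-⊘ᵗ (node _ _) = refl

γᵗ-⊕ᵗ : ∀ i s t → NonEmpty (children t) → γᵗ i (s ⊕ᵗ t) ≡ s ⊕ᵗ γᵗ i t
γᵗ-⊕ᵗ i (node a [])       (node b (c ∷ cs)) cons =
  cong (λ l → node l (attach (pred i) (c ∷ cs))) (sym (+-suc a b))
γᵗ-⊕ᵗ i (node a (d ∷ ds)) (node b (c ∷ cs)) cons =
  cong₂ node (sym (+-suc a b)) (attach-++ (pred i) (d ∷ ds) c cs)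

γ₁-⊕ᵗ : ∀ t → NonEmpty (children t) → γᵗ 1 t ≡ t ⊕ᵗ λᵗ 1 leaf
γ₁-⊕ᵗ (node a (c ∷ cs)) cons = cong (λ l → node l (c ∷ cs ++ [ leaf ])) (+-comm 1 a)

-- The new root lengthens the right path by one edge, whence `suc i`. As `1 ≤ i`, the leaf is
-- attached at or below the old root, so both nodes labeled `k` lie on the raised path.
γᵗ-λᵗ : ∀ {i} k t → 1 ≤ i → NonEmpty (children t) →
        γᵗ (suc i) (λᵗ k t) ≡ λᵗ (suc k) (γᵗ i t)
γᵗ-λᵗ _ (node _ (_ ∷ _)) (s≤s _) cons = refl

-- Needed where the tail is a stuck `⊘ᶠ` or `attach`.
hᶠ-∷ : ∀ i bs {ds} → NonEmpty ds →
       hᶠ (node i bs ∷ ds) ≡ hᶠ ds ⊘ᵗ γᵗ i (hᶠ bs)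
hᶠ-∷ _ _ cons = refl

-- On the way back up the right path, `hᶠ` applies only `γᵗ i` and grafting on the right. Both act
-- on the last summand, so `hᶠ (d ∷ ds)` stays in front.
hᶠ-⊘ᶠ : ∀ {c cs} d ds → All Admissible (c ∷ cs) →
        hᶠ ((c ∷ cs) ⊘ᶠ (d ∷ ds)) ≡ hᶠ (d ∷ ds) ⊕ᵗ hᶠ (c ∷ cs)
-- The identified node has label 1, hence `γᵗ 1`; and `hᶠ [ leaf ]` is `λᵗ 1 leaf`.
hᶠ-⊘ᶠ d ds (external ∷ []) = γ₁-⊕ᵗ (hᶠ (d ∷ ds)) (hᶠ-nonEmpty d ds)
hᶠ-⊘ᶠ d ds (inner {i} {b} {bs} _ _ r ∷ []) = begin
  γᵗ i (hᶠ ((b ∷ bs) ⊘ᶠ (d ∷ ds)))     ≡⟨ cong (γᵗ i) (hᶠ-⊘ᶠ d ds r) ⟩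
  γᵗ i (hᶠ (d ∷ ds) ⊕ᵗ hᶠ (b ∷ bs))    ≡⟨ γᵗ-⊕ᵗ i (hᶠ (d ∷ ds)) _ (hᶠ-nonEmpty b bs) ⟩
  hᶠ (d ∷ ds) ⊕ᵗ γᵗ i (hᶠ (b ∷ bs))    ∎
hᶠ-⊘ᶠ {node i bs} {c ∷ cs} d ds (_ ∷ r@(_ ∷ _)) = begin
  hᶠ (node i bs ∷ ((c ∷ cs) ⊘ᶠ (d ∷ ds)))
    ≡⟨ hᶠ-∷ i bs (⊘ᶠ-nonEmpty c cs (d ∷ ds)) ⟩
  hᶠ ((c ∷ cs) ⊘ᶠ (d ∷ ds)) ⊘ᵗ γᵗ i (hᶠ bs)
    ≡⟨ cong (_⊘ᵗ γᵗ i (hᶠ bs)) (hᶠ-⊘ᶠ d ds r) ⟩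
  (hᶠ (d ∷ ds) ⊕ᵗ hᶠ (c ∷ cs)) ⊘ᵗ γᵗ i (hᶠ bs)
    ≡⟨ ⊕ᵗ-⊘ᵗ (hᶠ (d ∷ ds)) (hᶠ (c ∷ cs)) _ (hᶠ-nonEmpty c cs) ⟩
  hᶠ (d ∷ ds) ⊕ᵗ (hᶠ (c ∷ cs) ⊘ᵗ γᵗ i (hᶠ bs))
    ∎

hᶠ-attach : ∀ k {c cs} → k < rpathᶠ (c ∷ cs) → All Admissible (c ∷ cs) →
            hᶠ (attach k (c ∷ cs)) ≡ λᵗ (suc k) (hᶠ (c ∷ cs))
-- Attaching at the root appends the summand `λᵗ 1 leaf`, which `hᶠ` fixes and moves to the front of
-- a graft.
hᶠ-attach zero {c} {cs} _ _ =
  trans (hᶠ-++ c cs leaf []) (λ₁leaf-⊘ᵗ (hᶠ (c ∷ cs)))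
hᶠ-attach (suc k) (s≤s ()) (external ∷ [])
-- `attach` has raised the label `i` of the last child, so the outer operation is `γᵗ (suc i)`.
hᶠ-attach (suc k) (s≤s k<) (inner {i} {b} {bs} 1≤i _ r ∷ []) = begin
  γᵗ (suc i) (hᶠ (attach k (b ∷ bs)))          ≡⟨ cong (γᵗ (suc i)) (hᶠ-attach k k< r) ⟩
  γᵗ (suc i) (λᵗ (suc k) (hᶠ (b ∷ bs)))        ≡⟨ γᵗ-λᵗ (suc k) _ 1≤i (hᶠ-nonEmpty b bs) ⟩
  λᵗ (suc (suc k)) (γᵗ i (hᶠ (b ∷ bs)))        ∎
hᶠ-attach (suc k) {node i bs} {c ∷ cs} k< (_ ∷ r@(_ ∷ _)) = begin
  hᶠ (node i bs ∷ attach (suc k) (c ∷ cs))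
    ≡⟨ hᶠ-∷ i bs (attach-nonEmpty (suc k) c cs) ⟩
  hᶠ (attach (suc k) (c ∷ cs)) ⊘ᵗ γᵗ i (hᶠ bs)
    ≡⟨ cong (_⊘ᵗ γᵗ i (hᶠ bs)) (hᶠ-attach (suc k) k< r) ⟩
  λᵗ (suc (suc k)) (hᶠ (c ∷ cs)) ⊘ᵗ γᵗ i (hᶠ bs)
    ≡⟨ λᵗ-⊘ᵗ (suc (suc k)) (hᶠ (c ∷ cs)) _ (hᶠ-nonEmpty c cs) ⟩
  λᵗ (suc (suc k)) (hᶠ (c ∷ cs) ⊘ᵗ γᵗ i (hᶠ bs))
    ∎

hᵗ : Tree → Tree
hᵗ t = hᶠ (children t)

hᵗ-γᵗ : ∀ {i t} → Valid t → γ-Index t i → hᵗ (γᵗ i t) ≡ λᵗ i (hᵗ t)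
-- The convention for γ₁ •: both sides are the tree with two nodes.
hᵗ-γᵗ _            single                   = refl
hᵗ-γᵗ single       (path (s≤s _) ())
hᵗ-γᵗ (rooted _ r) (path {i = suc k} _ k<) = hᶠ-attach k k< r

hᵗ-⊘ᵗ : ∀ {s t} → Valid s → NonEmpty (children s) → NonEmpty (children t) →
        hᵗ (s ⊘ᵗ t) ≡ hᵗ t ⊕ᵗ hᵗ s
hᵗ-⊘ᵗ {t = node _ (d ∷ ds)} (rooted _ r) cons cons = hᶠ-⊘ᶠ d ds r

mutual
  -- The order of the summands is reversed twice. The root label is the one forced by the children,
  -- which in a valid tree is the original one.
  hᵗ-hᶠ : ∀ {c cs} → All Admissible (c ∷ cs) →
          hᵗ (hᶠ (c ∷ cs)) ≡ node (labelSum (c ∷ cs)) (c ∷ cs)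
  hᵗ-hᶠ {node i bs} (p ∷ []) =
    trans (hᵗ-γᵗhᶠ p) (cong (λ l → node l [ node i bs ]) (sym (+-identityʳ i)))
  hᵗ-hᶠ {node i bs} {c ∷ cs} (p ∷ r@(_ ∷ _)) = begin
    hᵗ (hᶠ (c ∷ cs) ⊘ᵗ γᵗ i (hᶠ bs))
      ≡⟨ hᵗ-⊘ᵗ (hᶠ-valid r) (hᶠ-nonEmpty c cs) (γᵗ-nonEmpty i (hᶠ bs)) ⟩
    hᵗ (γᵗ i (hᶠ bs)) ⊕ᵗ hᵗ (hᶠ (c ∷ cs))
      ≡⟨ cong₂ _⊕ᵗ_ (hᵗ-γᵗhᶠ p) (hᵗ-hᶠ r) ⟩
    node (labelSum (node i bs ∷ c ∷ cs)) (node i bs ∷ c ∷ cs)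
      ∎

  hᵗ-γᵗhᶠ : ∀ {i cs} → Admissible (node i cs) →
            hᵗ (γᵗ i (hᶠ cs)) ≡ node i [ node i cs ]
  hᵗ-γᵗhᶠ external = refl
  hᵗ-γᵗhᶠ {i} p@(inner _ _ r) =
    trans (hᵗ-γᵗ (hᶠ-valid r) (hᶠ-index p)) (cong (λᵗ i) (hᵗ-hᶠ r))

theorem5 : (t : ℬ) → h (h t) ≡ t
theorem5 (_ , single)        = refl
theorem5 (_ , rooted refl r) = ℬ-≡ (hᵗ-hᶠ r)
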